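{- Let $\mathcal{H}$ be a family of graphs. There is a constant $C=C(\mathcal{H})$ such that $$\#\{v\in V(G):\operatorname{adh}(v)\ge 2\}\le C$$ for every $\mathcal{H}$-free graph $G$ if and only if $$\mathcal{H}\le\{K_n^*,\ nP_3,\ K_{1,n}^*\}$$ for some positive integer $n$.
   Context: All graphs are finite, undirected and simple (not necessarily connected). For graphs $H_1,H_2$, write $H_1\le H_2$ if $H_1$ is (isomorphic to) an induced subgraph of $H_2$. A graph $G$ is $\mathcal{H}$-free if there is no $H\in\mathcal{H}$ with $H\le G$. For families of graphs $\mathcal{H}_1,\mathcal{H}_2$, write $\mathcal{H}_1\le\mathcal{H}_2$ if for every $H_2\in\mathcal{H}_2$ there is $H_1\in\mathcal{H}_1$ with $H_1\le H_2$. For a graph $G$, $c(G)$ is its number of connected components. The adhesion of a vertex $v$ of $G$ is $\operatorname{adh}(v)=c(G-v)-c(G)+1$ (so $v$ is a cut vertex if and only if $\operatorname{adh}(v)\ge 2$). $K_n$ is the complete graph on $n$ vertices, $P_n$ the path on $n$ vertices, and $nG$ the disjoint union of $n$ copies of $G$. $K_{1,n}^*$ is obtained from the star $K_{1,n}$ by attaching one pendant vertex to each of its $n$ leaves. $K_n^*$ is obtained from $K_n$ by attaching one pendant vertex to every vertex of $K_n$. -}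

module Defs where

open import Level using (Level; 0ℓ; _⊔_) renaming (suc to lsuc)
open import Data.Bool using (Bool; true; false; T; not; _∧_; _∨_)
open import Data.Bool.Properties using (T?; T-∨; ∨-comm)
open import Data.Fin using (Fin; zero; suc; toℕ; punchIn; splitAt; remQuot)
import Data.Fin.Properties as Fin
open import Data.Integer using (ℤ; +_; 1ℤ)
import Data.Integer as ℤ
open import Data.List using (List; []; _∷_; length; filter; deduplicate; allFin)
open import Data.List.Membership.Propositional using () renaming (_∈_ to _∈ₗ_)
open import Data.List.Membership.Propositional.Properties using (∈-allFin)
open import Data.List.Relation.Unary.Any using (here; there)
open import Data.Nat using (ℕ; suc; _≡ᵇ_)
open import Data.Nat.Properties using (≡ᵇ⇒≡; 1+n≢n)
open import Data.Product using (∃-syntax; _×_; _,_)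
open import Data.Sum using (_⊎_; inj₁; inj₂)
open import Data.Unit using (tt)
open import Function using (id; _∘_)
open import Function.Bundles using (Equivalence)
open import Function.Definitions using (Injective)
open import Relation.Binary using (Rel; Decidable; Symmetric)
open import Relation.Binary.Construct.Closure.ReflexiveTransitive
  using (Star; ε; _◅_; _◅◅_; return)
open import Relation.Binary.PropositionalEquality using (_≡_; refl; subst)
open import Relation.Nullary using (yes; no; ¬_; map′; _⊎-dec_; _×-dec_)
open import Relation.Nullary.Decidable using (⌊_⌋)
open import Relation.Unary using (Pred; _∈_)

record Simple (V : Set) : Set where
  field
    adj : V → V → Bool

  Adj : Rel V 0ℓ
  Adj u v = T (adj u v)

  field
    adj-sym    : Symmetric Adj
    adj-irrefl : ∀ {v} → ¬ Adj v v

-- The null graph is allowed: it arises by deleting the vertex of K₁.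
record Graph : Set where
  constructor graph
  field
    {order} : ℕ
    simple  : Simple (Fin order)

  V : Set
  V = Fin order

  open Simple simple public

open Graph using (V; order; adj; Adj)

-- u and v are adjacent iff f u and f v are.  For injective f this is the
-- induced subgraph on the image of f; for bijective f, a relabelling.
pullback : {V W : Set} → (W → V) → Simple V → Simple W
pullback f S = record
  { adj        = λ u v → S.adj (f u) (f v)
  ; adj-sym    = S.adj-sym
  ; adj-irrefl = S.adj-irrefl
  }
  where
  module S = Simple S

infix 4 _≼_
_≼_ : Graph → Graph → Set
H ≼ G = ∃[ f ] Injective {A = V H} {B = V G} _≡_ _≡_ f
             × (∀ u v → adj H u v ≡ adj G (f u) (f v))

infixl 6 _-_
_-_ : (G : Graph) → V G → Graph
graph {suc n} S - v = graph (pullback (punchIn v) S)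

Family : (ℓ : Level) → Set (lsuc ℓ)
Family ℓ = Pred Graph ℓ

_-Free : ∀ {ℓ} → Family ℓ → Graph → Set ℓ
(ℋ -Free) G = ¬ (∃[ H ] H ∈ ℋ × H ≼ G)

infix 4 _≼ᶠ_
_≼ᶠ_ : ∀ {ℓ₁ ℓ₂} → Family ℓ₁ → Family ℓ₂ → Set (ℓ₁ ⊔ ℓ₂)
ℋ₁ ≼ᶠ ℋ₂ = ∀ H₂ → H₂ ∈ ℋ₂ → ∃[ H₁ ] H₁ ∈ ℋ₁ × H₁ ≼ H₂

Connected : (G : Graph) → Rel (V G) 0ℓ
Connected G = Star (Adj G)

-- Reachability on Fin n is decidable.  Via ws u v says that v can be
-- reached from u by a walk whose interior vertices all lie in ws
-- (the Floyd–Warshall recursion).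
module Reachability {n} {R : Rel (Fin n) 0ℓ} (R? : Decidable R) where

  Via : List (Fin n) → Rel (Fin n) 0ℓ
  Via []       u v = u ≡ v ⊎ R u v
  Via (w ∷ ws) u v = Via ws u v ⊎ (Via ws u w × Via ws w v)

  via? : ∀ ws → Decidable (Via ws)
  via? []       u v = (u Fin.≟ v) ⊎-dec R? u v
  via? (w ∷ ws) u v = via? ws u v ⊎-dec (via? ws u w ×-dec via? ws w v)

  via⇒star : ∀ ws {u v} → Via ws u v → Star R u v
  via⇒star []       (inj₁ refl)    = ε
  via⇒star []       (inj₂ r)       = return r
  via⇒star (w ∷ ws) (inj₁ p)       = via⇒star ws p
  via⇒star (w ∷ ws) (inj₂ (p , q)) = via⇒star ws p ◅◅ via⇒star ws q

  via-base : ∀ ws {u v} → u ≡ v ⊎ R u v → Via ws u v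
  via-base []       p = p
  via-base (w ∷ ws) p = inj₁ (via-base ws p)

  via-trans : ∀ ws {u w v} → w ∈ₗ ws → Via ws u w → Via ws w v → Via ws u v
  via-trans (x ∷ ws) (here refl) p q = inj₂ (into p , outof q)
    where
    into : ∀ {u} → Via (x ∷ ws) u x → Via ws u x
    into (inj₁ p)       = p
    into (inj₂ (p , _)) = p
    outof : ∀ {v} → Via (x ∷ ws) x v → Via ws x v
    outof (inj₁ q)       = q
    outof (inj₂ (_ , q)) = q
  via-trans (x ∷ ws) (there i) (inj₁ p) (inj₁ q) = inj₁ (via-trans ws i p q)
  via-trans (x ∷ ws) (there i) (inj₁ p) (inj₂ (q , r)) =
    inj₂ (via-trans ws i p q , r)
  via-trans (x ∷ ws) (there i) (inj₂ (p , q)) (inj₁ r) =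
    inj₂ (p , via-trans ws i q r)
  via-trans (x ∷ ws) (there i) (inj₂ (p , _)) (inj₂ (_ , r)) = inj₂ (p , r)

  star⇒via : ∀ {u v} → Star R u v → Via (allFin n) u v
  star⇒via ε        = via-base (allFin n) (inj₁ refl)
  star⇒via (r ◅ rs) = via-trans (allFin n) (∈-allFin _)
                        (via-base (allFin n) (inj₂ r)) (star⇒via rs)

  star? : Decidable (Star R)
  star? u v = map′ (via⇒star (allFin n)) star⇒via (via? (allFin n) u v)

connected? : (G : Graph) → Decidable (Connected G)
connected? G = Reachability.star? (λ u v → T? (adj G u v))

-- The vertex list with all but one vertex of each component removed.
c : Graph → ℕ
c G = length (deduplicate (connected? G) (allFin (order G)))

adh : (G : Graph) → V G → ℤ
adh G v = + c (G - v) ℤ.- + c G ℤ.+ 1ℤ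

cutVertices : (G : Graph) → List (V G)
cutVertices G = filter (λ v → + 2 ℤ.≤? adh G v) (allFin (order G))

#cutVertices : Graph → ℕ
#cutVertices = length ∘ cutVertices

fromAdj : ∀ {n} (a : Fin n → Fin n → Bool) →
          (∀ u v → T (a u v) → T (a v u)) → (∀ v → ¬ T (a v v)) → Graph
fromAdj a s i = graph record
  { adj = a ; adj-sym = λ {u v} → s u v ; adj-irrefl = λ {v} → i v }

K : ℕ → Graph
K n = fromAdj {n} (λ u v → not ⌊ u Fin.≟ v ⌋) symm irr
  where
  symm : ∀ u v → T (not ⌊ u Fin.≟ v ⌋) → T (not ⌊ v Fin.≟ u ⌋)
  symm u v p with u Fin.≟ v | v Fin.≟ u
  ... | no _   | no _     = tt
  ... | no u≢v | yes refl = u≢v refl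
  irr : ∀ v → ¬ T (not ⌊ v Fin.≟ v ⌋)
  irr v p with v Fin.≟ v
  ... | no v≢v = v≢v refl

P : ℕ → Graph
P n = fromAdj {n} a symm irr
  where
  a : Fin n → Fin n → Bool
  a u v = (suc (toℕ u) ≡ᵇ toℕ v) ∨ (suc (toℕ v) ≡ᵇ toℕ u)
  symm : ∀ u v → T (a u v) → T (a v u)
  symm u v = subst T (∨-comm (suc (toℕ u) ≡ᵇ toℕ v) _)
  irr : ∀ v → ¬ T (a v v)
  irr v p with Equivalence.to T-∨ p
  ... | inj₁ q = 1+n≢n (≡ᵇ⇒≡ _ (toℕ v) q)
  ... | inj₂ q = 1+n≢n (≡ᵇ⇒≡ _ (toℕ v) q)

-- The star K_{1,n}: centre zero, leaves suc i.
K₁, : ℕ → Graph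
K₁, n = fromAdj {suc n} a symm irr
  where
  a : Fin (suc n) → Fin (suc n) → Bool
  a zero    (suc _) = true
  a (suc _) zero    = true
  a _       _       = false
  symm : ∀ u v → T (a u v) → T (a v u)
  symm zero    (suc _) _ = tt
  symm (suc _) zero    _ = tt
  irr : ∀ v → ¬ T (a v v)
  irr zero    ()
  irr (suc _) ()

-- The disjoint union of k copies of G: vertex (i , v) is the copy of v in
-- the i-th summand.
infixr 7 _·_
_·_ : ℕ → Graph → Graph
k · G = graph (pullback (remQuot {k} (order G)) copies)
  where
  module G = Graph G
  a : Fin k × V G → Fin k × V G → Bool
  a (i , u) (j , v) = ⌊ i Fin.≟ j ⌋ ∧ G.adj u v
  symm : ∀ x y → T (a x y) → T (a y x)
  symm (i , u) (j , v) p with i Fin.≟ j | j Fin.≟ i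
  ... | yes _    | yes _  = G.adj-sym p
  ... | yes refl | no j≢i = j≢i refl
  irr : ∀ x → ¬ T (a x x)
  irr (i , u) p with i Fin.≟ i
  ... | yes _ = G.adj-irrefl p
  copies : Simple (Fin k × V G)
  copies = record
    { adj = a ; adj-sym = λ {x y} → symm x y ; adj-irrefl = λ {x} → irr x }

-- Attach k new pendant vertices to G, the p-th one to the vertex f p.
attach : (G : Graph) {k : ℕ} → (Fin k → V G) → Graph
attach G {k} f = graph (pullback (splitAt (order G)) extended)
  where
  module G = Graph G
  a : V G ⊎ Fin k → V G ⊎ Fin k → Bool
  a (inj₁ u) (inj₁ v) = G.adj u v
  a (inj₁ u) (inj₂ p) = ⌊ u Fin.≟ f p ⌋
  a (inj₂ p) (inj₁ u) = ⌊ u Fin.≟ f p ⌋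
  a (inj₂ _) (inj₂ _) = false
  symm : ∀ x y → T (a x y) → T (a y x)
  symm (inj₁ _) (inj₁ _) = G.adj-sym
  symm (inj₁ _) (inj₂ _) = id
  symm (inj₂ _) (inj₁ _) = id
  irr : ∀ x → ¬ T (a x x)
  irr (inj₁ _) = G.adj-irrefl
  irr (inj₂ _) ()
  extended : Simple (V G ⊎ Fin k)
  extended = record
    { adj = a ; adj-sym = λ {x y} → symm x y ; adj-irrefl = λ {x} → irr x }

K* : ℕ → Graph
K* n = attach (K n) id

K₁,* : ℕ → Graph
K₁,* n = attach (K₁, n) suc

{-# OPTIONS --safe #-}
module Submission where

-- A cut vertex v has neighbours a and b lying in different components of G − v.
-- Take two cut vertices v and v′.  After exchanging the roles of a and b at both, either
-- neither lies in the a-component of the other ("Anti"), or v′ lies in the b-component of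
-- v and v in the a-component of v′ ("Chain").  By Ramsey's theorem many cut vertices
-- contain many that are pairwise in the same situation.
--   Chain: in v₀, …, v₄ the vertex v₂ separates the paths a₀v₀b₀ and a₄v₄b₄, so Ramsey
--   again gives many pairwise anticomplete induced P₃.
--   Anti: the edges vᵢaᵢ are pendant with respect to each other.  Homogenise the adjacencies
--   among the vᵢ and bᵢ.  If the vᵢ form a clique, they span K*.  Otherwise they are
--   independent, and either some bᵢ is adjacent to many vⱼ, which gives K₁,*, or the edges
--   vᵢbᵢ are pendant as well; then the bᵢ span K* if they form a clique, and the paths
--   aᵢvᵢbᵢ are anticomplete if they are independent.
-- Conversely the three graphs have at least n cut vertices (for n ≥ 2), so a bound C
-- prevents them from being ℋ-free for n = C + 2.

open import Defs
open import Axiom.ExcludedMiddle using (ExcludedMiddle)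
open import Data.Bool using (true; false; T; _∧_; not)
open import Data.Bool.Properties using (T?)
open import Data.Fin using
  (Fin; zero; suc; punchIn; punchOut; _↑ˡ_; _↑ʳ_; splitAt; join; remQuot; combine)
open import Data.Fin.Patterns using (0F; 1F; 2F)
import Data.Fin.Properties as Fin
open import Data.Integer using (+_; +≤+)
import Data.Integer as ℤ
import Data.Integer.Properties as ℤ
open import Data.List using
  (List; []; _∷_; length; lookup; map; reverse; deduplicate; allFin)
open import Data.List.Properties using
  (length-map; length-tabulate; length-reverse; unfold-reverse)
open import Data.List.Membership.Propositional.Properties using (∈-allFin; ∈-lookup; ∈-filter⁺)
open import Data.List.Relation.Binary.Permutation.Propositional using (↭-sym)
open import Data.List.Relation.Binary.Permutation.Propositional.Properties
  using (All-resp-↭; ↭-reverse)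
open import Data.List.Relation.Binary.Sublist.Propositional
  using (_⊆_; []; _∷_; _∷ʳ_; ⊆-trans; minimum)
open import Data.List.Relation.Binary.Sublist.Propositional.Properties using (All-resp-⊆)
open import Data.List.Relation.Unary.All using (All; []; _∷_)
import Data.List.Relation.Unary.All as All
import Data.List.Relation.Unary.All.Properties as All
open import Data.List.Relation.Unary.AllPairs using (AllPairs; []; _∷_)
import Data.List.Relation.Unary.AllPairs as AllPairs
import Data.List.Relation.Unary.AllPairs.Properties as AllPairs
open import Data.List.Relation.Unary.Any using (Any; index)
import Data.List.Relation.Unary.Any as Any
import Data.List.Relation.Unary.Any.Properties as Any
import Data.List.Relation.Unary.Unique.DecSetoid.Properties as Unique
open import Data.List.Relation.Unary.Unique.Propositional.Properties using (allFin⁺; filter⁺)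
open import Data.Maybe using (Maybe; just; nothing)
open import Data.Nat using (ℕ; zero; suc; _+_; _≤_; _<_; z≤n; s≤s)
import Data.Nat.Properties as ℕ
open import Data.Product using (∃-syntax; _×_; _,_; proj₁; proj₂; uncurry)
open import Data.Sum using (_⊎_; inj₁; inj₂; [_,_]′)
import Data.Sum as Sum
open import Data.Unit using (tt)
open import Function using (_∘_; id; _on_)
open import Function.Bundles using (_⇔_; mk⇔)
open import Function.Definitions using (Injective)
open import Level using (0ℓ)
open import Relation.Binary using (Rel; Symmetric; Decidable; DecSetoid)
open import Relation.Binary.Construct.Closure.ReflexiveTransitive
  using (Star; ε; _◅_; _◅◅_; return; gmap)
import Relation.Binary.Construct.Closure.ReflexiveTransitive as Star
open import Relation.Binary.PropositionalEquality
  using (_≡_; _≢_; refl; sym; trans; cong; cong₂; subst; subst₂; ≢-sym)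
open import Relation.Nullary using (Dec; ¬_; yes; no; contradiction; ¬?; _×-dec_)
open import Relation.Nullary.Decidable using (decidable-stable; ⌊_⌋; toWitness; fromWitness)
open import Relation.Unary using (_∪_; ｛_｝; _∈_)

open Graph using (V; order; Adj; adj; adj-sym; adj-irrefl)

-- Pigeonhole counting with lists.

AllPairs-lookup : {A : Set} {R : Rel A 0ℓ} → Symmetric R → ∀ {xs} → AllPairs R xs →
  ∀ {i j} → i ≢ j → R (lookup xs i) (lookup xs j)
AllPairs-lookup s (r ∷ rs) {zero}  {zero}  i≢j = contradiction refl i≢j
AllPairs-lookup s (r ∷ rs) {zero}  {suc j} i≢j = All.lookup r (∈-lookup j)
AllPairs-lookup s (r ∷ rs) {suc i} {zero}  i≢j = s (All.lookup r (∈-lookup i))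
AllPairs-lookup s (r ∷ rs) {suc i} {suc j} i≢j = AllPairs-lookup s rs (i≢j ∘ cong suc)

-- Sending each entry of `xs` to the position of a related entry of `ys` is injective, since no `y`
-- is related to two entries. A relation in place of a function lets components be counted through
-- their representatives.
pigeonhole : {A B : Set} (R : A → B → Set) {xs : List A} {ys : List B} →
  AllPairs (λ x x′ → ∀ y → R x y → ¬ R x′ y) xs →
  All (λ x → Any (R x) ys) xs → length xs ≤ length ys
pigeonhole R {xs} {ys} apart cover = Fin.injective⇒≤ {f = f} inj
  where
  hit : ∀ i → Any (R (lookup xs i)) ys
  hit i = All.lookup cover (∈-lookup i)
  f : Fin (length xs) → Fin (length ys)
  f i = index (hit i)
  inj : ∀ {i j} → f i ≡ f j → i ≡ j
  inj {i} {j} fi≡fj = decidable-stable (i Fin.≟ j) λ i≢j →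
    AllPairs-lookup {R = λ x x′ → ∀ y → R x y → ¬ R x′ y} (λ h y p q → h y q p) apart i≢j _
      (Any.lookup-index (hit i))
      (subst (λ k → R (lookup xs j) (lookup ys k)) (sym fi≡fj) (Any.lookup-index (hit j)))

-- Components before and after the deletion of a vertex.

connected-sym : ∀ G {u v} → Connected G u v → Connected G v u
connected-sym G = Star.reverse (adj-sym G)

connectedDecSetoid : Graph → DecSetoid 0ℓ 0ℓ
connectedDecSetoid G = record
  { Carrier = V G
  ; _≈_ = Connected G
  ; isDecEquivalence = record
    { isEquivalence = record { refl = ε ; sym = connected-sym G ; trans = _◅◅_ }
    ; _≟_ = connected? G
    }
  }

representatives : (G : Graph) → List (V G)
representatives G = deduplicate (connected? G) (allFin (order G))

representatives-apart : ∀ G → AllPairs (λ u v → ¬ Connected G u v) (representatives G)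
representatives-apart G = Unique.deduplicate-! (connectedDecSetoid G) (allFin (order G))

representative : ∀ G v → Any (Connected G v) (representatives G)
representative G v =
  Any.deduplicate⁺ (connected? G) (λ y~x v~x → v~x ◅◅ connected-sym G y~x)
    (Any.map (λ { refl → ε }) (∈-allFin v))

module _ {n} (S : Simple (Fin (suc n))) (v : Fin (suc n)) where
  private
    G  = graph S
    G′ = G - v

  Split : Set
  Split = ∃[ a ] ∃[ b ] (Adj G v (punchIn v a) × Adj G v (punchIn v b) × ¬ Connected G′ a b)

  split? : Dec Split
  split? = Fin.any? λ a → Fin.any? λ b →
    T? (adj G v (punchIn v a)) ×-dec T? (adj G v (punchIn v b)) ×-dec ¬? (connected? G′ a b)

  lower : ∀ {x y} → Connected G′ x y → Connected G (punchIn v x) (punchIn v y)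
  lower = gmap (punchIn v) id

  adj-punchOut : ∀ {x y} (v≢x : v ≢ x) (v≢y : v ≢ y) → Adj G x y →
    Adj G′ (punchOut v≢x) (punchOut v≢y)
  adj-punchOut v≢x v≢y =
    subst₂ (Adj G) (sym (Fin.punchIn-punchOut v≢x)) (sym (Fin.punchIn-punchOut v≢y))

  -- A walk through v leaves it at a neighbour, which is joined to the neighbour of entry.
  bypass : ¬ Split → ∀ {x y} (v≢x : v ≢ x) (v≢y : v ≢ y) → Connected G x y →
    Connected G′ (punchOut v≢x) (punchOut v≢y)
  bypass-from-v : ¬ Split → ∀ {x y} (v≢x : v ≢ x) (v≢y : v ≢ y) → Adj G v x →
    Connected G v y → Connected G′ (punchOut v≢x) (punchOut v≢y)
  bypass ¬s v≢x v≢y ε =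
    subst (Connected G′ _) (Fin.punchOut-cong v refl) ε
  bypass ¬s {x} v≢x v≢y (_◅_ {j = z} xz zy) with v Fin.≟ z
  ... | yes refl = bypass-from-v ¬s v≢x v≢y (adj-sym G xz) zy
  ... | no v≢z   = adj-punchOut v≢x v≢z xz ◅ bypass ¬s v≢z v≢y zy
  bypass-from-v ¬s v≢x v≢y vx ε = contradiction refl v≢y
  bypass-from-v ¬s v≢x v≢y vx (_◅_ {j = z} vz zy) with v Fin.≟ z
  ... | yes refl = contradiction vz (adj-irrefl G)
  ... | no v≢z = joined ◅◅ bypass ¬s v≢z v≢y zy
    where
    nbr : ∀ {w} (v≢w : v ≢ w) → Adj G v w → Adj G v (punchIn v (punchOut v≢w))
    nbr v≢w = subst (Adj G v) (sym (Fin.punchIn-punchOut v≢w))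
    joined : Connected G′ (punchOut v≢x) (punchOut v≢z)
    joined = decidable-stable (connected? G′ _ _) λ ¬c →
      ¬s (_ , _ , nbr v≢x vx , nbr v≢z vz , ¬c)

  -- By `bypass`, remaining vertices joined in G are still joined in G - v, so representatives of G
  -- - v lie in distinct components of G.
  c-without-split : ¬ Split → c G′ ≤ c G
  c-without-split ¬s =
    pigeonhole (λ x y → Connected G (punchIn v x) y)
      (AllPairs.map (λ ¬xx′ _ xy x′y → ¬xx′ (raise (xy ◅◅ connected-sym G x′y)))
        (representatives-apart G′))
      (All.universal (λ x → representative G (punchIn v x)) _)
    where
    raise : ∀ {x x′} → Connected G (punchIn v x) (punchIn v x′) → Connected G′ x x′
    raise p = subst₂ (Connected G′) (Fin.punchOut-punchIn v) (Fin.punchOut-punchIn v)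
      (bypass ¬s (Fin.punchInᵢ≢i v _ ∘ sym) (Fin.punchInᵢ≢i v _ ∘ sym) p)

  -- Components of G inject into those of G − v so that the component of a is missed:
  -- the component of v is sent to that of b.
  c-with-split : Split → c G < c G′
  c-with-split (a , b , va , vb , ¬ab) =
    -- The additional entry `nothing` stands for the component of `a` and makes the inequality
    -- strict.
    subst (_≤ c G′) (cong suc (length-map just (representatives G)))
      (pigeonhole R {xs = nothing ∷ map just (representatives G)}
        (All.map⁺ (All.universal (λ _ _ ya (_ , ¬ya) → ¬ya ya) _)
          ∷ AllPairs.map⁺ (AllPairs.map
              (λ ¬xx′ _ (xy , _) (x′y , _) → ¬xx′ (xy ◅◅ connected-sym G x′y))
              (representatives-apart G)))
        (Any.map (connected-sym G′) (representative G′ a)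
          ∷ All.map⁺ (All.universal cover _)))
    where
    R : Maybe (V G) → V G′ → Set
    R nothing  y = Connected G′ y a
    R (just x) y = Connected G x (punchIn v y) × ¬ Connected G′ y a
    via-b : ∀ {x} → Connected G x (punchIn v b) → Any (R (just x)) (representatives G′)
    via-b xb = Any.map (λ by → xb ◅◅ lower by , λ ya → ¬ab (connected-sym G′ (by ◅◅ ya)))
                 (representative G′ b)
    cover : ∀ x → Any (R (just x)) (representatives G′)
    cover x with v Fin.≟ x
    ... | yes refl = via-b (return vb)
    ... | no v≢x with connected? G′ (punchOut v≢x) a
    ...   | yes xa = via-b (subst (λ u → Connected G u (punchIn v b)) (Fin.punchIn-punchOut v≢x)
                       (lower xa ◅◅ adj-sym G va ◅ return vb))
    ...   | no ¬xa = Any.map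
              (λ xy → subst (λ u → Connected G u (punchIn v _)) (Fin.punchIn-punchOut v≢x) (lower xy)
                    , λ ya → ¬xa (xy ◅◅ ya))
              (representative G′ (punchOut v≢x))

-- From adhesion to separated neighbours.

2≤adh⇒c< : ∀ G v → + 2 ℤ.≤ adh G v → c G < c (G - v)
2≤adh⇒c< G v 2≤ with c G ℕ.<? c (G - v)
... | yes p = p
... | no ¬p with ℤ.≤-trans 2≤ (ℤ.+-monoˡ-≤ ℤ.1ℤ (ℤ.i≤j⇒i-j≤0 (+≤+ (ℕ.≮⇒≥ ¬p))))
...   | +≤+ (s≤s ())

c<⇒2≤adh : ∀ G v → c G < c (G - v) → + 2 ℤ.≤ adh G v
-- The adhesion `i + 1` is rewritten as two successors of `ℤ.pred i`, which is nonnegative.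
c<⇒2≤adh G v c< = subst (+ 2 ℤ.≤_) (trans (cong ℤ.suc (ℤ.suc-pred i)) (ℤ.+-comm ℤ.1ℤ i))
  (ℤ.suc-mono (ℤ.suc-mono 0≤pred))
  where
  i = + c (G - v) ℤ.- + c G
  0≤pred : ℤ.0ℤ ℤ.≤ ℤ.pred i
  0≤pred = subst (ℤ.0ℤ ℤ.≤_) (ℤ.minus-suc (+ c (G - v)) (c G)) (ℤ.i≤j⇒0≤j-i (+≤+ c<))

-- Walks of G - v are described inside G, so that different cut vertices can be compared on one
-- vertex set.
Avoid : (G : Graph) → V G → Rel (V G) 0ℓ
Avoid G v x y = Adj G x y × v ≢ x × v ≢ y

record Cut (G : Graph) : Set where
  constructor cut
  field
    v a b : V G
    va    : Adj G v a
    vb    : Adj G v b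
    apart : ¬ Star (Avoid G v) a b

2≤adh⇒Cut : ∀ G v → + 2 ℤ.≤ adh G v → ∃[ κ ] Cut.v {G} κ ≡ v
2≤adh⇒Cut (graph {suc n} S) v 2≤ with split? S v
... | no ¬s = contradiction (2≤adh⇒c< (graph S) v 2≤) (ℕ.≤⇒≯ (c-without-split S v ¬s))
... | yes (a , b , va , vb , ¬ab) = cut v (punchIn v a) (punchIn v b) va vb ¬avoiding , refl
  where
  avoid⇒connected : ∀ {x y} (v≢x : v ≢ x) (v≢y : v ≢ y) → Star (Avoid (graph S) v) x y →
    Connected (graph S - v) (punchOut v≢x) (punchOut v≢y)
  avoid⇒connected v≢x v≢y ε = subst (Connected (graph S - v) _) (Fin.punchOut-cong v refl) ε
  avoid⇒connected v≢x v≢y ((xz , _ , v≢z) ◅ zy) =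
    adj-punchOut S v v≢x v≢z xz ◅ avoid⇒connected v≢z v≢y zy
  ¬avoiding : ¬ Star (Avoid (graph S) v) (punchIn v a) (punchIn v b)
  ¬avoiding p = ¬ab (subst₂ (Connected (graph S - v)) (Fin.punchOut-punchIn v) (Fin.punchOut-punchIn v)
    (avoid⇒connected (Fin.punchInᵢ≢i v a ∘ sym) (Fin.punchInᵢ≢i v b ∘ sym) p))

cuts : ∀ G → ∃[ κs ] length κs ≡ #cutVertices G × AllPairs (_≢_ on Cut.v {G}) κs
cuts G with choose (All.map (λ {v} → 2≤adh⇒Cut G v) (All.all-filter (λ v → + 2 ℤ.≤? adh G v) (allFin (order G))))
  where
  choose : ∀ {vs} → All (λ v → ∃[ κ ] Cut.v {G} κ ≡ v) vs → ∃[ κs ] map (Cut.v {G}) κs ≡ vs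
  choose [] = [] , refl
  choose ((κ , eq) ∷ h) with choose h
  ... | κs , eqs = κ ∷ κs , cong₂ _∷_ eq eqs
... | κs , eq = κs
  , trans (sym (length-map Cut.v κs)) (cong length eq)
  , AllPairs.map⁻ (subst (AllPairs _≢_) (sym eq) (filter⁺ (λ v → + 2 ℤ.≤? adh G v) (allFin⁺ (order G))))

-- Cut vertices of the three graphs.

≤#cutVertices : ∀ G {n} (f : Fin n → V G) → Injective _≡_ _≡_ f → (∀ i → + 2 ℤ.≤ adh G (f i)) →
  n ≤ #cutVertices G
≤#cutVertices G {n} f f-inj f-cut = subst (_≤ #cutVertices G) (length-tabulate id)
  (pigeonhole (λ i v → f i ≡ v)
    (AllPairs.tabulate⁺ (λ i≢j _ fi≡v fj≡v → i≢j (f-inj (trans fi≡v (sym fj≡v)))))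
    (All.tabulate⁺ (λ i → ∈-filter⁺ (λ v → + 2 ℤ.≤? adh G v) (∈-allFin (f i)) (f-cut i))))

-- In G - v the vertex `p` is isolated, so it is separated from `u`.
pendant-cut : ∀ G {p v u} → (∀ w → Adj G p w → w ≡ v) → Adj G v p → Adj G v u → p ≢ u →
  + 2 ℤ.≤ adh G v
pendant-cut (graph {suc n} S) {p} {v} {u} only vp vu p≢u = c<⇒2≤adh G v (c-with-split S v
  (punchOut (loopless vp) , punchOut (loopless vu)
    , subst (Adj G v) (sym (Fin.punchIn-punchOut (loopless vp))) vp
    , subst (Adj G v) (sym (Fin.punchIn-punchOut (loopless vu))) vu
    , λ w → p≢u (trans (sym (Fin.punchIn-punchOut (loopless vp)))
        (trans (cong (punchIn v) (stuck w)) (Fin.punchIn-punchOut (loopless vu))))))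
  where
  G = graph S
  loopless : ∀ {x} → Adj G v x → v ≢ x
  loopless vx refl = adj-irrefl G vx
  stuck : ∀ {y} → Connected (G - v) (punchOut (loopless vp)) y → punchOut (loopless vp) ≡ y
  stuck ε = refl
  stuck (_◅_ {j = w} pw _) = contradiction
    (only (punchIn v w) (subst (λ x → Adj G x (punchIn v w)) (Fin.punchIn-punchOut (loopless vp)) pw))
    (Fin.punchInᵢ≢i v w)

attach-cut : ∀ G {k} (f : Fin k → V G) p {u} → Adj G (f p) u →
  + 2 ℤ.≤ adh (attach G f) (f p ↑ˡ k)
attach-cut G {k} f p {u} fp-u = pendant-cut (attach G f) {order G ↑ʳ p} {f p ↑ˡ k} {u ↑ˡ k}
  only fp-p fp-u′ p≢u
  where
  p≢u : order G ↑ʳ p ≢ u ↑ˡ k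
  p≢u eq with trans (sym (Fin.splitAt-↑ʳ (order G) k p))
                (trans (cong (splitAt (order G)) eq) (Fin.splitAt-↑ˡ (order G) u k))
  ... | ()
  only : ∀ w → Adj (attach G f) (order G ↑ʳ p) w → w ≡ f p ↑ˡ k
  only w h rewrite Fin.splitAt-↑ʳ (order G) k p with splitAt (order G) w in eq
  ... | inj₁ x = trans (sym (Fin.splitAt⁻¹-↑ˡ eq)) (cong (_↑ˡ k) (toWitness h))
  fp-p : Adj (attach G f) (f p ↑ˡ k) (order G ↑ʳ p)
  fp-p rewrite Fin.splitAt-↑ʳ (order G) k p | Fin.splitAt-↑ˡ (order G) (f p) k = fromWitness refl
  fp-u′ : Adj (attach G f) (f p ↑ˡ k) (u ↑ˡ k)
  fp-u′ rewrite Fin.splitAt-↑ˡ (order G) (f p) k | Fin.splitAt-↑ˡ (order G) u k = fp-u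

K*-#cutVertices : ∀ n → 2 + n ≤ #cutVertices (K* (2 + n))
K*-#cutVertices n = ≤#cutVertices (K* (2 + n)) (_↑ˡ (2 + n)) (Fin.↑ˡ-injective (2 + n) _ _)
  λ i → attach-cut (K (2 + n)) id i {other i} (i-other i)
  where
  other : Fin (2 + n) → Fin (2 + n)
  other zero    = suc zero
  other (suc _) = zero
  i-other : ∀ i → Adj (K (2 + n)) i (other i)
  i-other zero    = tt
  i-other (suc _) = tt

K₁,*-#cutVertices : ∀ n → n ≤ #cutVertices (K₁,* n)
K₁,*-#cutVertices n = ≤#cutVertices (K₁,* n) (λ i → suc i ↑ˡ n)
  (Fin.suc-injective ∘ Fin.↑ˡ-injective n _ _)
  λ i → attach-cut (K₁, n) suc i {zero} tt

·P₃-#cutVertices : ∀ n → n ≤ #cutVertices (n · P 3)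
·P₃-#cutVertices n = ≤#cutVertices (n · P 3) (λ i → combine i 1F)
  (λ {i} {j} eq → proj₁ (Fin.combine-injective i 1F j 1F eq))
  λ i → pendant-cut (n · P 3) {combine i 0F} {combine i 1F} {combine i 2F}
    (λ w h → trans (sym (Fin.combine-remQuot {n} 3 w)) (cong (uncurry combine)
      (only i (remQuot {n} 3 w) (subst (λ x → CopyAdj x (remQuot {n} 3 w)) (Fin.remQuot-combine i 0F) h))))
    (adjacent i 1F 0F tt) (adjacent i 1F 2F tt)
    (λ eq → Fin.0≢1+n (proj₂ (Fin.combine-injective i 0F i 2F eq)))
  where
  CopyAdj : Rel (Fin n × Fin 3) 0ℓ
  CopyAdj (i , x) (j , y) = T (⌊ i Fin.≟ j ⌋ ∧ adj (P 3) x y)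
  adjacent : ∀ i x y → Adj (P 3) x y → Adj (n · P 3) (combine i x) (combine i y)
  adjacent i x y xy =
    subst₂ CopyAdj (sym (Fin.remQuot-combine i x)) (sym (Fin.remQuot-combine i y)) copy
    where
    copy : CopyAdj (i , x) (i , y)
    copy with i Fin.≟ i
    ... | yes _  = xy
    ... | no i≢i = contradiction refl i≢i
  only : ∀ i w → CopyAdj (i , 0F) w → w ≡ (i , 1F)
  only i (j , y) h with i Fin.≟ j
  only i (j , 1F) h | yes refl = refl

-- Recognising induced copies.

T⇒≡true : ∀ {x} → T x → true ≡ x
T⇒≡true {true} _ = refl

¬T⇒≡false : ∀ {x} → ¬ T x → false ≡ x
¬T⇒≡false {true}  ¬t = contradiction tt ¬t
¬T⇒≡false {false} _  = refl

adj-comm : ∀ G x y → adj G x y ≡ adj G y x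
adj-comm G x y with adj G x y in xy | adj G y x in yx
... | true  | true  = refl
... | false | false = refl
... | true  | false = contradiction (adj-sym G (subst T (sym xy) tt)) (subst T yx)
... | false | true  = contradiction (adj-sym G (subst T (sym yx) tt)) (subst T xy)

attach-≼ : ∀ {H G k} (f : Fin k → V H) (h : V H → V G) (g : Fin k → V G) →
  Injective _≡_ _≡_ h → Injective _≡_ _≡_ g → (∀ u p → h u ≢ g p) →
  (∀ u v → adj H u v ≡ adj G (h u) (h v)) →
  (∀ u p → ⌊ u Fin.≟ f p ⌋ ≡ adj G (h u) (g p)) →
  (∀ p q → ¬ Adj G (g p) (g q)) →
  attach H f ≼ G
attach-≼ {H} {G} {k} f h g h-inj g-inj h≢g hh hg gg = e ∘ splitAt (order H) , e-inj , e-adj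
  where
  e : V H ⊎ Fin k → V G
  e = [ h , g ]′
  e-inj′ : ∀ x y → e x ≡ e y → x ≡ y
  e-inj′ (inj₁ u) (inj₁ v) eq = cong inj₁ (h-inj eq)
  e-inj′ (inj₁ u) (inj₂ q) eq = contradiction eq (h≢g u q)
  e-inj′ (inj₂ p) (inj₁ v) eq = contradiction (sym eq) (h≢g v p)
  e-inj′ (inj₂ p) (inj₂ q) eq = cong inj₂ (g-inj eq)
  e-inj : Injective _≡_ _≡_ (e ∘ splitAt (order H))
  e-inj {x} {y} eq = trans (sym (Fin.join-splitAt (order H) k x))
    (trans (cong (join (order H) k) (e-inj′ (splitAt (order H) x) (splitAt (order H) y) eq)) (Fin.join-splitAt (order H) k y))
  e-adj : ∀ x y → adj (attach H f) x y ≡ adj G (e (splitAt (order H) x)) (e (splitAt (order H) y))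
  e-adj x y with splitAt (order H) x | splitAt (order H) y
  ... | inj₁ u | inj₁ v = hh u v
  ... | inj₁ u | inj₂ q = hg u q
  ... | inj₂ p | inj₁ v = trans (hg v p) (adj-comm G (h v) (g p))
  ... | inj₂ p | inj₂ q = ¬T⇒≡false (gg p q)

module _ {G : Graph} where
  private
    _~_ : V G → V G → Set
    _~_ = Adj G

  adj⇒≢ : ∀ {x y} → x ~ y → x ≢ y
  adj⇒≢ xy refl = adj-irrefl G xy

  -- The pattern common to `K*` and `K₁,*`; adjacencies among the `q i` are left open, to be fixed
  -- as a clique or as an independent set.
  record PendantEdges {n} (q p : Fin n → V G) : Set where
    field
      matched : ∀ i → q i ~ p i
      private-leaf : ∀ {i j} → i ≢ j → ¬ q i ~ p j
      independent  : ∀ {i j} → i ≢ j → ¬ p i ~ p j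

    p-independent : ∀ i j → ¬ p i ~ p j
    p-independent i j with i Fin.≟ j
    ... | yes refl = adj-irrefl G
    ... | no i≢j   = independent i≢j

    -- Adjacency tells the vertices apart: if `p i` and `p j` coincided, `q i` would be adjacent to
    -- `p j`.
    p-injective : Injective _≡_ _≡_ p
    p-injective {i} {j} pi≡pj = decidable-stable (i Fin.≟ j) λ i≢j →
      private-leaf i≢j (subst (q i ~_) pi≡pj (matched i))

    q-injective : Injective _≡_ _≡_ q
    q-injective {i} {j} qi≡qj = decidable-stable (i Fin.≟ j) λ i≢j →
      private-leaf i≢j (subst (_~ p j) (sym qi≡qj) (matched j))

    q≢p : ∀ i j → q i ≢ p j
    q≢p i j qi≡pj = p-independent j i (subst (_~ p i) qi≡pj (matched i))

    matching : ∀ i j → ⌊ i Fin.≟ j ⌋ ≡ adj G (q i) (p j)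
    matching i j with i Fin.≟ j
    ... | yes refl = T⇒≡true (matched i)
    ... | no i≢j   = ¬T⇒≡false (private-leaf i≢j)

  K*-≼ : ∀ {n} (q p : Fin n → V G) → PendantEdges q p → (∀ {i j} → i ≢ j → q i ~ q j) → K* n ≼ G
  K*-≼ q p pe clique = attach-≼ {G = G} id q p q-injective p-injective q≢p qq matching p-independent
    where
    open PendantEdges pe
    qq : ∀ i j → not ⌊ i Fin.≟ j ⌋ ≡ adj G (q i) (q j)
    qq i j with i Fin.≟ j
    ... | yes refl = ¬T⇒≡false (adj-irrefl G)
    ... | no i≢j   = T⇒≡true (clique i≢j)

  K₁,*-≼ : ∀ {n} x (q p : Fin n → V G) → PendantEdges q p → (∀ {i j} → i ≢ j → ¬ q i ~ q j) →
    (∀ i → x ~ q i) → (∀ i → x ≢ p i × ¬ x ~ p i) → K₁,* n ≼ G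
  K₁,*-≼ {n} x q p pe indep xq xp = attach-≼ {G = G} suc h p h-inj p-injective h≢p hh hp p-independent
    where
    open PendantEdges pe
    h : Fin (suc n) → V G
    h zero    = x
    h (suc i) = q i
    h-inj : Injective _≡_ _≡_ h
    h-inj {zero}  {zero}  _  = refl
    h-inj {zero}  {suc j} eq = contradiction eq (adj⇒≢ (xq j))
    h-inj {suc i} {zero}  eq = contradiction (sym eq) (adj⇒≢ (xq i))
    h-inj {suc i} {suc j} eq = cong suc (q-injective eq)
    h≢p : ∀ i j → h i ≢ p j
    h≢p zero    j = proj₁ (xp j)
    h≢p (suc i) j = q≢p i j
    hh : ∀ i j → adj (K₁, n) i j ≡ adj G (h i) (h j)
    hh zero    zero    = ¬T⇒≡false (adj-irrefl G)
    hh zero    (suc j) = T⇒≡true (xq j)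
    hh (suc i) zero    = T⇒≡true (adj-sym G (xq i))
    hh (suc i) (suc j) with i Fin.≟ j
    ... | yes refl = ¬T⇒≡false (adj-irrefl G)
    ... | no i≢j   = ¬T⇒≡false (indep i≢j)
    hp : ∀ i j → ⌊ i Fin.≟ suc j ⌋ ≡ adj G (h i) (p j)
    hp zero    j = ¬T⇒≡false (proj₂ (xp j))
    hp (suc i) j with i Fin.≟ j | matching i j
    ... | yes _ | eq = eq
    ... | no _  | eq = eq

  ·-≼ : ∀ {H n} (t : Fin n → V H → V G) →
    (∀ i → Injective _≡_ _≡_ (t i)) → (∀ i x y → adj H x y ≡ adj G (t i x) (t i y)) →
    (∀ {i j} → i ≢ j → ∀ x y → t i x ≢ t j y × ¬ t i x ~ t j y) → n · H ≼ G
  ·-≼ {H} {n} t t-inj t-adj free =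
    e ∘ remQuot {n} (order H) , e-inj , λ x y → e-adj (remQuot {n} (order H) x) (remQuot {n} (order H) y)
    where
    e : Fin n × V H → V G
    e (i , x) = t i x
    e-inj′ : ∀ x y → e x ≡ e y → x ≡ y
    e-inj′ (i , x) (j , y) eq with i Fin.≟ j
    ... | yes refl = cong (i ,_) (t-inj i eq)
    ... | no i≢j   = contradiction eq (proj₁ (free i≢j x y))
    e-inj : Injective _≡_ _≡_ (e ∘ remQuot {n} (order H))
    e-inj {x} {y} eq = trans (sym (Fin.combine-remQuot {n} (order H) x))
      (trans (cong (uncurry combine) (e-inj′ _ _ eq)) (Fin.combine-remQuot {n} (order H) y))
    e-adj : ∀ x y → ⌊ proj₁ x Fin.≟ proj₁ y ⌋ ∧ adj H (proj₂ x) (proj₂ y) ≡ adj G (e x) (e y)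
    e-adj (i , x) (j , y) with i Fin.≟ j
    ... | yes refl = t-adj i x y
    ... | no i≢j   = ¬T⇒≡false (proj₂ (free i≢j x y))

-- Ramsey's theorem for lists.

ramsey : ℕ → ℕ → ℕ
ramsey zero    _       = 0
ramsey (suc _) zero    = 0
ramsey (suc a) (suc b) = suc (ramsey a (suc b) + ramsey (suc a) b)

module _ {A : Set} where

  AllPairs-resp-⊆ : {R : Rel A 0ℓ} → ∀ {xs ys} → ys ⊆ xs → AllPairs R xs → AllPairs R ys
  AllPairs-resp-⊆ []         []       = []
  AllPairs-resp-⊆ (_ ∷ʳ s)   (_ ∷ rs) = AllPairs-resp-⊆ s rs
  AllPairs-resp-⊆ (refl ∷ s) (r ∷ rs) = All-resp-⊆ s r ∷ AllPairs-resp-⊆ s rs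

  AllPairs-reverse : {R : Rel A 0ℓ} → ∀ {xs} → AllPairs R xs → AllPairs (λ x y → R y x) (reverse xs)
  AllPairs-reverse [] = []
  AllPairs-reverse {R} {x ∷ xs} (r ∷ rs) =
    subst (AllPairs (λ x y → R y x)) (sym (unfold-reverse x xs))
      (AllPairs.++⁺ (AllPairs-reverse rs) ([] ∷ [])
        (All.map (_∷ []) (All-resp-↭ (↭-sym (↭-reverse xs)) r)))

  partition : {P Q : A → Set} → ∀ {xs} → All (λ x → P x ⊎ Q x) xs →
    ∃[ ys ] ∃[ zs ] (ys ⊆ xs × All P ys) × (zs ⊆ xs × All Q zs) × length ys + length zs ≡ length xs
  partition [] = [] , [] , ([] , []) , ([] , []) , refl
  partition (pq ∷ pqs) with partition pqs | pq
  ... | ys , zs , (ys⊆ , ps) , (zs⊆ , qs) , eq | inj₁ p =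
    _ ∷ ys , zs , (refl ∷ ys⊆ , p ∷ ps) , (_ ∷ʳ zs⊆ , qs) , cong suc eq
  ... | ys , zs , (ys⊆ , ps) , (zs⊆ , qs) , eq | inj₂ q =
    ys , _ ∷ zs , (_ ∷ʳ ys⊆ , ps) , (refl ∷ zs⊆ , q ∷ qs) , trans (ℕ.+-suc _ _) (cong suc eq)

  Sub : Rel A 0ℓ → ℕ → List A → Set
  Sub R n xs = ∃[ ys ] ys ⊆ xs × AllPairs R ys × length ys ≡ n

  sub-⊆ : ∀ {R n xs ys} → ys ⊆ xs → Sub R n ys → Sub R n xs
  sub-⊆ ys⊆xs (zs , zs⊆ys , h) = zs , ⊆-trans zs⊆ys ys⊆xs , h

  sub-∷ : ∀ {R n x xs ys} → ys ⊆ xs → All (R x) ys → Sub R n ys → Sub R (suc n) (x ∷ xs)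
  sub-∷ ys⊆xs r (zs , zs⊆ys , rs , eq) =
    _ ∷ zs , refl ∷ ⊆-trans zs⊆ys ys⊆xs , All-resp-⊆ zs⊆ys r ∷ rs , cong suc eq

  +-≤-split : ∀ {a b c d} → a + b ≤ c + d → a ≤ c ⊎ b ≤ d
  +-≤-split {a} {b} {c} {d} h with a ℕ.≤? c | b ℕ.≤? d
  ... | yes p | _     = inj₁ p
  ... | no _  | yes q = inj₂ q
  ... | no ¬p | no ¬q = contradiction h (ℕ.<⇒≱ (ℕ.+-mono-< (ℕ.≰⇒> ¬p) (ℕ.≰⇒> ¬q)))

  -- The tail is partitioned by its relation to the head, and one part is long enough for induction.
  -- In closed form, `ramsey a b` is the binomial coefficient of a + b over a, minus 1. Pairs are
  -- read in list order, which admits asymmetric relations such as `Chain`.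
  ramsey-sub : ∀ a b {R S : Rel A 0ℓ} {xs} → AllPairs (λ x y → R x y ⊎ S x y) xs →
    ramsey a b ≤ length xs → Sub R a xs ⊎ Sub S b xs
  ramsey-sub zero    b       _ _ = inj₁ ([] , minimum _ , [] , refl)
  ramsey-sub (suc a) zero    _ _ = inj₂ ([] , minimum _ , [] , refl)
  ramsey-sub (suc a) (suc b) (rs ∷ rss) (s≤s big) with partition rs
  ... | ys , zs , (ys⊆ , ry) , (zs⊆ , sz) , eq with +-≤-split (subst (_ ≤_) (sym eq) big)
  ...   | inj₁ big-ys = Sum.map (sub-∷ ys⊆ ry) (sub-⊆ (_ ∷ʳ ys⊆))
                          (ramsey-sub a (suc b) (AllPairs-resp-⊆ ys⊆ rss) big-ys)
  ...   | inj₂ big-zs = Sum.map (sub-⊆ (_ ∷ʳ zs⊆)) (sub-∷ zs⊆ sz)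
                          (ramsey-sub (suc a) b (AllPairs-resp-⊆ zs⊆ rss) big-zs)

  -- With continuations, successive applications nest as a decision tree.
  ramsey-elim : ∀ a b {R S : Rel A 0ℓ} {C : Set} →
    (∀ {ys} → AllPairs R ys → length ys ≡ a → C) → (∀ {ys} → AllPairs S ys → length ys ≡ b → C) →
    ∀ {xs} → AllPairs (λ x y → R x y ⊎ S x y) xs → ramsey a b ≤ length xs → C
  ramsey-elim a b f g h big =
    [ (λ (_ , _ , rs , eq) → f rs eq) , (λ (_ , _ , ss , eq) → g ss eq) ]′ (ramsey-sub a b h big)

  -- Both alternatives keep `R`, so repeated refinement accumulates conditions.
  refine : {R P : Rel A 0ℓ} → Decidable P → ∀ {xs} → AllPairs R xs →
    AllPairs (λ x y → (R x y × P x y) ⊎ (R x y × ¬ P x y)) xs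
  refine {R} {P} P? = AllPairs.map λ {x} {y} r → dec x y r
    where
    dec : ∀ x y → R x y → (R x y × P x y) ⊎ (R x y × ¬ P x y)
    dec x y r with P? x y
    ... | yes p = inj₁ (r , p)
    ... | no ¬p = inj₂ (r , ¬p)

-- The 5 counts the cut vertices in `chain-free`: two outer paths, the separating vertex and a
-- buffer on each side of it.
chainBound : ℕ → ℕ
chainBound = ramsey 5

-- One Ramsey number for each adjacency homogenised in `anti-unavoidable`. Each `suc n` allows for a
-- centre besides the n leaves of a star.
antiBound : ℕ → ℕ
antiBound n = ramsey n (ramsey (suc n) (ramsey (suc n) (ramsey n n)))

-- The nesting follows the four cases of `classify`, in their order.
cutBound : ℕ → ℕ
cutBound n = ramsey (antiBound n) (ramsey (antiBound n) (ramsey (chainBound n) (chainBound n)))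

Unavoidable : ℕ → Graph → Set
Unavoidable n G = K* n ≼ G ⊎ n · P 3 ≼ G ⊎ K₁,* n ≼ G

-- Relative position of two cut vertices.

module _ {G : Graph} where
  open Cut

  private
    _~_ : V G → V G → Set
    _~_ = Adj G

    ~-sym : Symmetric _~_
    ~-sym = adj-sym G

    ~⇒≢ : ∀ {x y} → x ~ y → x ≢ y
    ~⇒≢ = adj⇒≢ {G}

  avoiding-sym : ∀ {u} → Symmetric (Star (Avoid G u))
  avoiding-sym = Star.reverse λ (xy , u≢x , u≢y) → ~-sym xy , u≢y , u≢x

  swap : Cut G → Cut G
  swap κ = cut (v κ) (b κ) (a κ) (vb κ) (va κ) (apart κ ∘ avoiding-sym)

  -- The `a`-component of G - v; `Inside (swap κ)` is the `b`-component.
  Inside : Cut G → V G → Set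
  Inside κ = Star (Avoid G (v κ)) (a κ)

  inside? : Decidable Inside
  inside? κ = Reachability.star?
    (λ x y → T? (adj G x y) ×-dec ¬? (v κ Fin.≟ x) ×-dec ¬? (v κ Fin.≟ y)) (a κ)

  inside⇒≢ : ∀ κ {x} → Inside κ x → v κ ≢ x
  inside⇒≢ κ = go (~⇒≢ (va κ))
    where
    go : ∀ {x y} → v κ ≢ x → Star (Avoid G (v κ)) x y → v κ ≢ y
    go v≢x ε = v≢x
    go v≢x ((_ , _ , v≢z) ◅ zy) = go v≢z zy

  inside-step : ∀ κ {x y} → Inside κ x → x ~ y → v κ ≢ y → Inside κ y
  inside-step κ ax xy v≢y = ax ◅◅ return (xy , inside⇒≢ κ ax , v≢y)

  swap-disjoint : ∀ κ {x} → Inside κ x → ¬ Inside (swap κ) x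
  swap-disjoint κ ax bx = apart κ (ax ◅◅ avoiding-sym bx)

  record Anti (κ μ : Cut G) : Set where
    constructor mkAnti
    field
      v≢v    : v κ ≢ v μ
      v-outˡ : ¬ Inside κ (v μ)
      v-outʳ : ¬ Inside μ (v κ)

  anti-sym : Symmetric Anti
  anti-sym (mkAnti v≢ p q) = mkAnti (≢-sym v≢) q p

  -- A directed relation: `μ` follows `κ` on its `b`-side. Swapping the sides reverses the
  -- direction.
  record Chain (κ μ : Cut G) : Set where
    constructor mkChain
    field
      v≢v  : v κ ≢ v μ
      next : Inside (swap κ) (v μ)
      prev : Inside μ (v κ)

  chain-swap : ∀ {κ μ} → Chain κ μ → Chain (swap μ) (swap κ)
  chain-swap (mkChain v≢ p q) = mkChain (≢-sym v≢) q p

  -- If both `Anti` cases fail, some `a`-component and some `b`-component contain the other cut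
  -- vertex. Sides of one cut are disjoint, so these belong to different cuts, which is a `Chain` up
  -- to swapping.
  classify : ∀ {κ μ} → v κ ≢ v μ →
    Anti κ μ ⊎ Anti (swap κ) (swap μ) ⊎ Chain κ μ ⊎ Chain (swap κ) (swap μ)
  classify {κ} {μ} v≢ with inside? κ (v μ) | inside? μ (v κ)
                         | inside? (swap κ) (v μ) | inside? (swap μ) (v κ)
  ... | no ¬p | no ¬q | _      | _      = inj₁ (mkAnti v≢ ¬p ¬q)
  ... | _     | _     | no ¬p′ | no ¬q′ = inj₂ (inj₁ (mkAnti v≢ ¬p′ ¬q′))
  ... | yes p | _     | yes p′ | _      = contradiction p′ (swap-disjoint κ p)
  ... | _     | yes q | _      | yes q′ = contradiction q′ (swap-disjoint μ q)
  ... | no _  | yes q | yes p′ | no _   = inj₂ (inj₂ (inj₁ (mkChain v≢ p′ q)))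
  ... | yes p | no _  | no _   | yes q′ = inj₂ (inj₂ (inj₂ (mkChain v≢ p q′)))

  -- A walk from a common vertex back to `a κ` stays in the `a`-component of `κ` and so misses
  -- `v μ`. It therefore places `a κ`, and then its neighbour `v κ`, in the `a`-component of `μ`.
  anti-disjoint : ∀ {κ μ x} → Anti κ μ → Inside κ x → ¬ Inside μ x
  anti-disjoint {κ} {μ} (mkAnti v≢ ¬p ¬q) ax μx =
    ¬q (inside-step μ (back ε ax μx) (~-sym (va κ)) (≢-sym v≢))
    where
    back : ∀ {x y} → Inside κ x → Star (Avoid G (v κ)) x y → Inside μ y → Inside μ x
    back ax ε μx = μx
    back ax (xz ◅ zy) μy =
      inside-step μ (back (ax ◅◅ return xz) zy μy) (~-sym (proj₁ xz))
        λ v≡x → ¬p (subst (Inside κ) (sym v≡x) ax)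

  anti-v≁a : ∀ {κ μ} → Anti κ μ → ¬ v κ ~ a μ
  anti-v≁a {κ} {μ} (mkAnti v≢ _ ¬q) va′ = ¬q (inside-step μ ε (~-sym va′) (≢-sym v≢))

  -- Such an edge would put `a μ` into both `a`-components.
  anti-a≁a : ∀ {κ μ} → Anti κ μ → ¬ a κ ~ a μ
  anti-a≁a {κ} {μ} anti@(mkAnti _ _ ¬q) aa = anti-disjoint anti
    (inside-step κ ε aa λ v≡a → ¬q (subst (Inside μ) (sym v≡a) ε)) ε

  Indep : Rel (Cut G) 0ℓ
  Indep κ μ = Anti κ μ × ¬ v κ ~ v μ

  indep-sym : Symmetric Indep
  indep-sym (anti , ¬vv) = anti-sym anti , ¬vv ∘ ~-sym

  indep-b≢a : ∀ {κ μ} → Indep κ μ → b κ ≢ a μ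
  indep-b≢a {κ} (anti , _) eq = anti-v≁a anti (subst (v κ ~_) eq (vb κ))

  -- Otherwise `a μ`, `b κ`, `v κ` is a walk avoiding `v μ`; here `b κ` differs from `v μ` because
  -- `v κ` is not adjacent to `v μ`.
  indep-b≁a : ∀ {κ μ} → Indep κ μ → ¬ b κ ~ a μ
  indep-b≁a {κ} {μ} ((mkAnti v≢ _ ¬q) , ¬vv) ba =
    ¬q (inside-step μ (inside-step μ ε (~-sym ba) λ v≡b → ¬vv (subst (v κ ~_) (sym v≡b) (vb κ)))
      (~-sym (vb κ)) (≢-sym v≢))

  b≢a : ∀ κ → b κ ≢ a κ
  b≢a κ eq = apart κ (subst (Inside κ) (sym eq) ε)

  b≁a : (κ : Cut G) → ¬ b κ ~ a κ
  b≁a κ ba = apart κ (return (~-sym ba , ~⇒≢ (va κ) , ~⇒≢ (vb κ)))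

  anti⇒pendantEdges : ∀ {κs} → AllPairs Anti κs → PendantEdges {G} (v ∘ lookup κs) (a ∘ lookup κs)
  anti⇒pendantEdges {κs} anti = record
    { matched      = λ i → va (lookup κs i)
    ; private-leaf = λ i≢j → anti-v≁a (AllPairs-lookup {R = Anti} anti-sym anti i≢j)
    ; independent  = λ i≢j → anti-a≁a (AllPairs-lookup {R = Anti} anti-sym anti i≢j)
    }

  vClique-≼ : ∀ {κs} → AllPairs (λ κ μ → Anti κ μ × v κ ~ v μ) κs → K* (length κs) ≼ G
  vClique-≼ h = K*-≼ {G} _ _ (anti⇒pendantEdges (AllPairs.map proj₁ h))
    λ i≢j → AllPairs-lookup {R = _~_ on v} ~-sym (AllPairs.map proj₂ h) i≢j

  -- The centre is `b κ`, the leaves are the `v μ`, and their pendants are the `a μ`.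
  star-≼ : ∀ {κ κs} → All (λ μ → Indep κ μ × b κ ~ v μ) κs → AllPairs Indep κs →
    K₁,* (length κs) ≼ G
  star-≼ {κ} {κs} spokes h = K₁,*-≼ {G} (b κ) _ _ (anti⇒pendantEdges (AllPairs.map proj₁ h))
    (λ i≢j → proj₂ (AllPairs-lookup {R = Indep} indep-sym h i≢j))
    (λ i → proj₂ (All.lookup spokes (∈-lookup i)))
    (λ i → let indep = proj₁ (All.lookup spokes (∈-lookup {xs = κs} i)) in indep-b≢a indep , indep-b≁a indep)

  -- Adjacency of a `b` to a `v` is asymmetric, so both directions are excluded; the relation then
  -- holds regardless of list order.
  Exclusive : Rel (Cut G) 0ℓ
  Exclusive κ μ = (Indep κ μ × ¬ b κ ~ v μ) × ¬ b μ ~ v κ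

  exclusive-sym : Symmetric Exclusive
  exclusive-sym ((indep , p) , q) = (indep-sym indep , q) , p

  bClique-≼ : ∀ {κs} → AllPairs (λ κ μ → Exclusive κ μ × b κ ~ b μ) κs → K* (length κs) ≼ G
  bClique-≼ {κs} h = K*-≼ {G} _ _ pendants
    λ i≢j → AllPairs-lookup {R = _~_ on b} ~-sym (AllPairs.map proj₂ h) i≢j
    where
    excl = λ {i} {j} → AllPairs-lookup {R = Exclusive} exclusive-sym (AllPairs.map proj₁ h) {i} {j}
    pendants : PendantEdges {G} (b ∘ lookup κs) (v ∘ lookup κs)
    pendants = record
      { matched      = λ i → ~-sym (vb (lookup κs i))
      ; private-leaf = λ i≢j → proj₂ (proj₁ (excl i≢j))
      ; independent  = λ i≢j → proj₂ (proj₁ (proj₁ (excl i≢j)))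
      }

  path : Cut G → Fin 3 → V G
  path κ 0F = a κ
  path κ 1F = v κ
  path κ 2F = b κ

  path-injective : ∀ κ {x y} → path κ x ≡ path κ y → x ≡ y
  path-injective κ {0F} {0F} _  = refl
  path-injective κ {1F} {1F} _  = refl
  path-injective κ {2F} {2F} _  = refl
  path-injective κ {0F} {1F} eq = contradiction (sym eq) (~⇒≢ (va κ))
  path-injective κ {1F} {0F} eq = contradiction eq (~⇒≢ (va κ))
  path-injective κ {1F} {2F} eq = contradiction eq (~⇒≢ (vb κ))
  path-injective κ {2F} {1F} eq = contradiction (sym eq) (~⇒≢ (vb κ))
  path-injective κ {0F} {2F} eq = contradiction (sym eq) (b≢a κ)
  path-injective κ {2F} {0F} eq = contradiction eq (b≢a κ)

  path-adj : ∀ κ x y → adj (P 3) x y ≡ adj G (path κ x) (path κ y)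
  path-adj κ 0F 0F = ¬T⇒≡false (adj-irrefl G)
  path-adj κ 0F 1F = T⇒≡true (~-sym (va κ))
  path-adj κ 0F 2F = ¬T⇒≡false (b≁a κ ∘ ~-sym)
  path-adj κ 1F 0F = T⇒≡true (va κ)
  path-adj κ 1F 1F = ¬T⇒≡false (adj-irrefl G)
  path-adj κ 1F 2F = T⇒≡true (vb κ)
  path-adj κ 2F 0F = ¬T⇒≡false (b≁a κ)
  path-adj κ 2F 1F = T⇒≡true (~-sym (vb κ))
  path-adj κ 2F 2F = ¬T⇒≡false (adj-irrefl G)

  Free : Rel (Cut G) 0ℓ
  Free κ μ = ∀ x y → ¬ path κ x ~ path μ y

  free? : Decidable Free
  free? κ μ = Fin.all? λ x → Fin.all? λ y → ¬? (T? (adj G (path κ x) (path μ y)))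

  free-sym : Symmetric Free
  free-sym h x y = h y x ∘ ~-sym

  -- A common vertex would have a neighbour on the first path, adjacent to the second path.
  free⇒≢ : ∀ {κ μ} → Free κ μ → ∀ x y → path κ x ≢ path μ y
  free⇒≢ {κ} h 0F y eq = h 1F y (subst (v κ ~_) eq (va κ))
  free⇒≢ {κ} h 1F y eq = h 0F y (subst (a κ ~_) eq (~-sym (va κ)))
  free⇒≢ {κ} h 2F y eq = h 1F y (subst (v κ ~_) eq (vb κ))

  paths-≼ : ∀ {κs} → AllPairs Free κs → length κs · P 3 ≼ G
  paths-≼ {κs} h = ·-≼ {G} {H = P 3} (path ∘ lookup κs) (λ i → path-injective _) (λ i → path-adj _)
    λ i≢j x y → free⇒≢ (free i≢j) x y , free i≢j x y
    where
    free = λ {i} {j} → AllPairs-lookup {R = Free} free-sym h {i} {j}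

  exclusive⇒free : ∀ {κ μ} → Exclusive κ μ × ¬ b κ ~ b μ → Free κ μ
  exclusive⇒free (((indep@(anti , vv) , bv) , bv′) , bb) = λ where
    0F 0F → anti-a≁a anti
    0F 1F → anti-v≁a (anti-sym anti) ∘ ~-sym
    0F 2F → indep-b≁a (indep-sym indep) ∘ ~-sym
    1F 0F → anti-v≁a anti
    1F 1F → vv
    1F 2F → bv′ ∘ ~-sym
    2F 0F → indep-b≁a indep
    2F 1F → bv
    2F 2F → bb

  Near : Cut G → V G → Set
  Near κ x = v κ ≡ x ⊎ v κ ~ x

  path-near : ∀ κ x → Near κ (path κ x)
  path-near κ 0F = inj₂ (va κ)
  path-near κ 1F = inj₁ refl
  path-near κ 2F = inj₂ (vb κ)

  -- Since `v κ` lies in the `a`-component of `ν`, so does its neighbour `x`, unless `x` is `v ν`.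
  -- In that case the edge from `v κ` would put `v ν` into the `a`-component of `μ`, but it lies in
  -- the `b`-component.
  chain-near : ∀ {κ μ ν x} → Chain κ μ → Chain κ ν → Chain μ ν → Near κ x → Inside ν x
  chain-near {κ} {μ} {ν} {x} (mkChain _ _ κ-in-μ) (mkChain _ _ κ-in-ν) (mkChain v≢ ν-in-μ′ _) = near
    where
    near : Near κ x → Inside ν x
    near (inj₁ refl) = κ-in-ν
    near (inj₂ vx) with v ν Fin.≟ x
    ... | no v≢x   = inside-step ν κ-in-ν vx v≢x
    ... | yes refl = contradiction ν-in-μ′ (swap-disjoint μ (inside-step μ κ-in-μ vx v≢))

  -- The cuts `κ₁` and `κ₃` are the middle cuts for `chain-near`, which puts the outer paths on
  -- opposite sides of `κ₂`. An edge between them would join the two sides.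
  chain-free : ∀ {κ₀ κ₁ κ₂ κ₃ κ₄} → AllPairs Chain (κ₀ ∷ κ₁ ∷ κ₂ ∷ κ₃ ∷ κ₄ ∷ []) → Free κ₀ κ₄
  chain-free {κ₀} {κ₁} {κ₂} {κ₃} {κ₄}
    ((c₀₁ ∷ c₀₂ ∷ _) ∷ (c₁₂ ∷ _) ∷ (c₂₃ ∷ c₂₄ ∷ []) ∷ (c₃₄ ∷ []) ∷ [] ∷ []) x y xy =
      swap-disjoint κ₂ (inside-step κ₂ left xy (inside⇒≢ (swap κ₂) right)) right
    where
    left : Inside κ₂ (path κ₀ x)
    left = chain-near c₀₁ c₀₂ c₁₂ (path-near κ₀ x)
    right : Inside (swap κ₂) (path κ₄ y)
    right = chain-near (chain-swap c₃₄) (chain-swap c₂₄) (chain-swap c₂₃) (path-near κ₄ y)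

  -- Extracting an unavoidable graph by Ramsey's theorem.

  resize : ∀ {m n} → Unavoidable m G → m ≡ n → Unavoidable n G
  resize u refl = u

  chain-unavoidable : ∀ n {κs} → AllPairs Chain κs → chainBound n ≤ length κs → Unavoidable n G
  chain-unavoidable n h = ramsey-elim 5 n clash (resize ∘ inj₂ ∘ inj₁ ∘ paths-≼ ∘ AllPairs.map proj₂)
    (AllPairs.map Sum.swap (refine {P = Free} free? h))
    where
    clash : ∀ {κs} → AllPairs (λ κ μ → Chain κ μ × ¬ Free κ μ) κs → length κs ≡ 5 → Unavoidable n G
    clash {_ ∷ _ ∷ _ ∷ _ ∷ _ ∷ []} h@((_ ∷ _ ∷ _ ∷ (_ , ¬free) ∷ []) ∷ _) _ =
      contradiction (chain-free (AllPairs.map proj₁ h)) ¬free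

  -- Each `split` either produces one of the graphs or adds a non-adjacency; after three of them the
  -- relation is `Exclusive`.
  anti-unavoidable : ∀ n {κs} → AllPairs Anti κs → antiBound n ≤ length κs → Unavoidable n G
  anti-unavoidable n =
    split (λ κ μ → T? (adj G (v κ) (v μ))) (resize ∘ inj₁ ∘ vClique-≼)
    (split (λ κ μ → T? (adj G (b κ) (v μ))) firstCentre
    (split (λ κ μ → T? (adj G (b μ) (v κ))) lastCentre
    λ h → ramsey-elim n n (resize ∘ inj₁ ∘ bClique-≼)
      (resize ∘ inj₂ ∘ inj₁ ∘ paths-≼ ∘ AllPairs.map exclusive⇒free)
      (refine (λ κ μ → T? (adj G (b κ) (b μ))) h)))
    where
    split : ∀ {m k R} {P : Rel (Cut G) 0ℓ} → Decidable P →
      (∀ {κs} → AllPairs (λ κ μ → R κ μ × P κ μ) κs → length κs ≡ m → Unavoidable n G) →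
      (∀ {κs} → AllPairs (λ κ μ → R κ μ × ¬ P κ μ) κs → k ≤ length κs → Unavoidable n G) →
      ∀ {κs} → AllPairs R κs → ramsey m k ≤ length κs → Unavoidable n G
    split P? f g h = ramsey-elim _ _ f (λ h eq → g h (ℕ.≤-reflexive (sym eq))) (refine P? h)
    firstCentre : ∀ {κs} → AllPairs (λ κ μ → Indep κ μ × b κ ~ v μ) κs → length κs ≡ suc n →
      Unavoidable n G
    firstCentre (spokes ∷ h) eq =
      resize (inj₂ (inj₂ (star-≼ spokes (AllPairs.map proj₁ h)))) (ℕ.suc-injective eq)
    lastCentre : ∀ {κs} → AllPairs (λ κ μ → (Indep κ μ × ¬ b κ ~ v μ) × b μ ~ v κ) κs →
      length κs ≡ suc n → Unavoidable n G
    -- Here the `b` of the last cut is adjacent to all earlier `v`; reversal makes that cut the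
    -- head.
    lastCentre {κs} h eq = firstCentre
      (AllPairs.map (λ ((indep , _) , bv) → indep-sym indep , bv) (AllPairs-reverse h))
      (trans (length-reverse κs) eq)

  -- The two swapped cases become the unswapped ones once `swap` is applied to the whole list.
  cuts-unavoidable : ∀ n {κs} → AllPairs (_≢_ on v) κs → cutBound n ≤ length κs → Unavoidable n G
  cuts-unavoidable n h =
    ramsey-elim _ _ (λ r → anti-unavoidable n r ∘ exact)
      (λ r → ramsey-elim _ _ (λ {κs} r → anti-unavoidable n (AllPairs.map⁺ r) ∘ swapped κs)
        (λ r → ramsey-elim _ _ (λ r → chain-unavoidable n r ∘ exact)
          (λ {κs} r → chain-unavoidable n (AllPairs.map⁺ r) ∘ swapped κs)
          r ∘ exact)
        r ∘ exact)
      (AllPairs.map classify h)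
    where
    exact : ∀ {m k} → m ≡ k → k ≤ m
    exact = ℕ.≤-reflexive ∘ sym
    swapped : ∀ κs {k} → length κs ≡ k → k ≤ length (map swap κs)
    swapped κs eq = exact (trans (length-map swap κs) eq)

-- Forbidden families and bounded numbers of cut vertices.

≼-trans : ∀ {G H I} → G ≼ H → H ≼ I → G ≼ I
≼-trans (f , f-inj , f-adj) (g , g-inj , g-adj) =
  g ∘ f , f-inj ∘ g-inj , λ u v → trans (f-adj u v) (g-adj (f u) (f v))

cutBound≤#cutVertices⇒unavoidable : ∀ n G → cutBound n ≤ #cutVertices G → Unavoidable n G
cutBound≤#cutVertices⇒unavoidable n G big with cuts G
... | κs , eq , distinct = cuts-unavoidable n distinct (subst (cutBound n ≤_) (sym eq) big)

corollary4p4 : ∀ {ℓ} → ExcludedMiddle ℓ → (ℋ : Family ℓ) →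
    (∃[ C ] (∀ G → (ℋ -Free) G → #cutVertices G ≤ C))
    ⇔ (∃[ n ] (0 < n × (ℋ ≼ᶠ (｛ K* n ｝ ∪ ｛ n · P 3 ｝ ∪ ｛ K₁,* n ｝))))
corollary4p4 {ℓ} em ℋ = mk⇔ bounded⇒≼ ≼⇒bounded
  where
  Forbids : ℕ → Set ℓ
  Forbids n = ℋ ≼ᶠ (｛ K* n ｝ ∪ ｛ n · P 3 ｝ ∪ ｛ K₁,* n ｝)

  -- n = C + 2 rather than C + 1, because K* 1 = K₂ has no cut vertex.
  bounded⇒≼ : ∃[ C ] (∀ G → (ℋ -Free) G → #cutVertices G ≤ C) → ∃[ n ] (0 < n × Forbids n)
  bounded⇒≼ (C , bounded) = 2 + C , s≤s z≤n , λ where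
      H (inj₁ refl)        → hit H (K*-#cutVertices C)
      H (inj₂ (inj₁ refl)) → hit H (·P₃-#cutVertices (2 + C))
      H (inj₂ (inj₂ refl)) → hit H (K₁,*-#cutVertices (2 + C))
    where
    hit : ∀ G → 2 + C ≤ #cutVertices G → ∃[ H ] H ∈ ℋ × H ≼ G
    -- As `ℋ` is an arbitrary predicate, excluded middle is what turns the failure of freeness into
    -- a member of `ℋ`.
    hit G many = decidable-stable em λ free →
      ℕ.<⇒≱ (ℕ.≤-trans (ℕ.n≤1+n _) many) (bounded G free)

  ≼⇒bounded : ∃[ n ] (0 < n × Forbids n) → ∃[ C ] (∀ G → (ℋ -Free) G → #cutVertices G ≤ C)
  ≼⇒bounded (n , _ , forbids) = cutBound n , λ G free →
    decidable-stable (#cutVertices G ℕ.≤? cutBound n) λ ¬≤ →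
      avoids G free (cutBound≤#cutVertices⇒unavoidable n G (ℕ.≰⇒≥ ¬≤))
    where
    avoids : ∀ G → (ℋ -Free) G → ¬ Unavoidable n G
    avoids G free = λ where
        (inj₁ K≼G)        → excluded (inj₁ refl) K≼G
        (inj₂ (inj₁ P≼G)) → excluded (inj₂ (inj₁ refl)) P≼G
        (inj₂ (inj₂ S≼G)) → excluded (inj₂ (inj₂ refl)) S≼G
      where
      excluded : ∀ {U} → U ∈ (｛ K* n ｝ ∪ ｛ n · P 3 ｝ ∪ ｛ K₁,* n ｝) → ¬ U ≼ G
      excluded {U} U∈ U≼G with forbids U U∈
      ... | H , H∈ℋ , H≼U = free (H , H∈ℋ , ≼-trans {H} {U} {G} H≼U U≼G)
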